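{- Let $G$ be a finite connected simple undirected graph and let $\sigma$ be the vertex ordering returned by the following two-pass procedure: (Pass 1) perform a maxBFS of $G$ and let $r$ be the last visited vertex; (Pass 2) perform a minBFS of $G$ starting from $r$ and let $\sigma$ be its visiting ordering. Then $G$ is a unit interval graph if and only if $\sigma$ is a Left-Right Ordering of $G$.
   Context: A graph is a unit interval graph (UIG), equivalently a proper interval graph, if it is the intersection graph of a collection of closed intervals of the real line all of the same length. A Left-Right Ordering of a graph $G=(V,E)$ is a total ordering of $V$ such that for any $a<b<c$, if $ac\in E$ then $ab\in E$ and $bc\in E$. BFS is the standard Breadth First Search implemented with a queue. A maxBFS (resp. minBFS) is a BFS in which ties between eligible vertices are broken by largest (resp. smallest) degree, degrees being taken in $G$ and fixed throughout: when a vertex is processed, its not yet discovered neighbours are put in the queue in decreasing (resp. increasing) order of degree, remaining ties broken arbitrarily. The maxBFS of Pass 1 starts at a vertex of maximum degree; the minBFS of Pass 2 starts at $r$. -}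

module Defs where

open import Data.Fin.Base using (Fin)
open import Data.List.Base using (List; []; _∷_; [_]; _++_; allFin; filter; last; length)
open import Data.List.Membership.Propositional using (_∈_; _∉_)
open import Data.List.Relation.Binary.Sublist.Propositional using (_⊆_)
open import Data.List.Relation.Unary.AllPairs using (AllPairs)
open import Data.List.Relation.Unary.Unique.Propositional using (Unique)
open import Data.Maybe.Base using (just)
import Data.Nat.Base as ℕ
open import Data.Nat.Base using (ℕ; _⊔_)
import Data.Nat.Properties as ℕ
open import Data.Product using (_×_; _,_; ∃-syntax; Σ-syntax)
open import Data.Rational.Base as ℚ using (ℚ; 0ℚ; ½; ∣_∣)
import Data.Rational.Properties as ℚ
open import Data.Rational.Solver using (module +-*-Solver)
open import Function.Bundles using (_⇔_)
open import Level using (0ℓ)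
open import Relation.Binary.Core using (Rel)
open import Relation.Binary.Construct.Closure.ReflexiveTransitive using (Star)
open import Relation.Binary.Definitions using (Decidable; Symmetric)
open import Relation.Binary.PropositionalEquality
  using (_≡_; _≢_; refl; cong; subst; subst₂)
open import Relation.Binary.Structures using (IsStrictTotalOrder)
open import Relation.Nullary using (¬_)

-- Real numbers as Cauchy sequences of rationals; their equality is _≃_,
-- not propositional equality.

Cauchy : (ℕ → ℚ) → Set
Cauchy x = ∀ ε → 0ℚ ℚ.< ε →
  ∃[ N ] ∀ m n → N ℕ.≤ m → N ℕ.≤ n → ∣ x m ℚ.- x n ∣ ℚ.< ε

record ℝ : Set where
  constructor mkℝ
  field
    seq    : ℕ → ℚ
    cauchy : Cauchy seq

open ℝ public

infix 4 _≤ᴿ_ _≃_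

-- The slack ε is essential: the limit of x is at most that of y iff,
-- for every ε > 0, eventually xₙ ≤ yₙ + ε.
_≤ᴿ_ : Rel ℝ 0ℓ
x ≤ᴿ y = ∀ ε → 0ℚ ℚ.< ε →
  ∃[ N ] ∀ n → N ℕ.≤ n → seq x n ℚ.≤ seq y n ℚ.+ ε

_≃_ : Rel ℝ 0ℓ
x ≃ y = x ≤ᴿ y × y ≤ᴿ x

private
  half-pos : ∀ ε → 0ℚ ℚ.< ε → 0ℚ ℚ.< ½ ℚ.* ε
  half-pos ε 0<ε =
    subst (ℚ._< ½ ℚ.* ε) (ℚ.*-zeroʳ ½) (ℚ.*-monoʳ-<-pos ½ 0<ε)

  halves : ∀ ε → ½ ℚ.* ε ℚ.+ ½ ℚ.* ε ≡ ε
  halves = solve 1 (λ ε → con ½ :* ε :+ con ½ :* ε := ε) refl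
    where open +-*-Solver

  regroup : ∀ a b c d → (a ℚ.- b) ℚ.- (c ℚ.- d) ≡ (a ℚ.- c) ℚ.- (b ℚ.- d)
  regroup = solve 4
    (λ a b c d → (a :- b) :- (c :- d) := (a :- c) :- (b :- d)) refl
    where open +-*-Solver

infixl 6 _-ᴿ_

_-ᴿ_ : ℝ → ℝ → ℝ
x -ᴿ y = mkℝ (λ n → seq x n ℚ.- seq y n) cau
  where
  cau : Cauchy (λ n → seq x n ℚ.- seq y n)
  cau ε 0<ε with cauchy x (½ ℚ.* ε) (half-pos ε 0<ε)
               | cauchy y (½ ℚ.* ε) (half-pos ε 0<ε)
  ... | M , x-close | N , y-close = M ⊔ N , λ m n M⊔N≤m M⊔N≤n →
    subst₂ ℚ._<_
      (cong ∣_∣ (regroup (seq x m) (seq x n) (seq y m) (seq y n)))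
      (halves ε)
      (ℚ.≤-<-trans
        (ℚ.∣p-q∣≤∣p∣+∣q∣ (seq x m ℚ.- seq x n) (seq y m ℚ.- seq y n))
        (ℚ.+-mono-<
          (x-close m n (ℕ.m⊔n≤o⇒m≤o M N M⊔N≤m) (ℕ.m⊔n≤o⇒m≤o M N M⊔N≤n))
          (y-close m n (ℕ.m⊔n≤o⇒n≤o M N M⊔N≤m) (ℕ.m⊔n≤o⇒n≤o M N M⊔N≤n))))

record ClosedInterval : Set where
  field
    lo hi : ℝ
    lo≤hi : lo ≤ᴿ hi

  width : ℝ
  width = hi -ᴿ lo

open ClosedInterval public

infix 4 _∈ᴵ_

_∈ᴵ_ : ℝ → ClosedInterval → Set
p ∈ᴵ I = lo I ≤ᴿ p × p ≤ᴿ hi I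

Intersect : Rel ClosedInterval 0ℓ
Intersect I J = ∃[ p ] p ∈ᴵ I × p ∈ᴵ J

record Graph (n : ℕ) : Set₁ where
  field
    Adj    : Rel (Fin n) 0ℓ
    adj?   : Decidable Adj
    sym    : Symmetric Adj
    irrefl : ∀ v → ¬ Adj v v

  degree : Fin n → ℕ
  degree v = length (filter (adj? v) (allFin n))

  Connected : Set
  Connected = ∀ u v → Star Adj u v

  MaximumDegree : Fin n → Set
  MaximumDegree v = ∀ u → degree u ℕ.≤ degree v

open Graph public using (Connected)

-- The intervals form a family indexed by the vertices, so distinct
-- vertices may receive the same interval.
UnitIntervalGraph : ∀ {n} → Graph n → Set
UnitIntervalGraph {n} G = Σ[ I ∈ (Fin n → ClosedInterval) ]
    (∀ u v → width (I u) ≃ width (I v))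
  × (∀ u v → u ≢ v → Adj u v ⇔ Intersect (I u) (I v))
  where open Graph G

record IsLeftRightOrdering {n} (G : Graph n) (_<_ : Rel (Fin n) 0ℓ) : Set where
  open Graph G
  field
    isStrictTotalOrder : IsStrictTotalOrder _≡_ _<_
    leftRight : ∀ {a b c} → a < b → b < c → Adj a c → Adj a b × Adj b c

-- The order of appearance in a list.  It is a strict total order only if
-- no element is repeated (irreflexivity) and, when n ≥ 2, every element
-- occurs (totality).
Precedes : ∀ {n} → List (Fin n) → Rel (Fin n) 0ℓ
Precedes σ a b = (a ∷ b ∷ []) ⊆ σ

-- Run G _≽_ queue discovered σ: from the given queue and discovered
-- vertices, some execution of the search visits vertices in the order σ.  When v is
-- processed, its undiscovered neighbours are enqueued as a list ns
-- arranged along _≽_; any such arrangement is allowed, so that _≽_-ties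
-- are broken arbitrarily.
data Run {n} (G : Graph n) (_≽_ : Rel (Fin n) 0ℓ) :
         (queue discovered σ : List (Fin n)) → Set where
  done : ∀ {discovered} → Run G _≽_ [] discovered []
  step : ∀ {v queue discovered σ} (ns : List (Fin n)) →
         Unique ns →
         (∀ w → w ∈ ns ⇔ (Graph.Adj G v w × w ∉ discovered)) →
         AllPairs _≽_ ns →
         Run G _≽_ (queue ++ ns) (discovered ++ ns) σ →
         Run G _≽_ (v ∷ queue) discovered (v ∷ σ)

BFS : ∀ {n} → Graph n → Rel (Fin n) 0ℓ → Fin n → List (Fin n) → Set
BFS G _≽_ s σ = Run G _≽_ [ s ] [ s ] σ

MaxBFS : ∀ {n} → Graph n → Fin n → List (Fin n) → Set
MaxBFS G = BFS G (λ u w → degree u ℕ.≥ degree w)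
  where open Graph G

MinBFS : ∀ {n} → Graph n → Fin n → List (Fin n) → Set
MinBFS G = BFS G (λ u w → degree u ℕ.≤ degree w)
  where open Graph G

record TwoPass {n} (G : Graph n) (σ : List (Fin n)) : Set where
  open Graph G
  field
    s        : Fin n
    s-max    : MaximumDegree s
    τ        : List (Fin n)
    pass₁    : MaxBFS G s τ
    r        : Fin n
    r-last   : last τ ≡ just r
    pass₂    : MinBFS G r σ

{-# OPTIONS --safe #-}

-- Suppose G is a unit interval graph, and order the vertices weakly by
-- left endpoint, with twins (vertices of equal closed neighbourhood)
-- tied.  In pass 1 the discovered set is always convex, and the last
-- vertex discovered, having least degree among its siblings, is a twin of
-- an end vertex.  From an end vertex, BFS discovers initial segments; if
-- y precedes x among the children of v, then N[y] ⊆ N[x], so increasing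
-- degree agrees with the order, twins apart, and σ is sorted.
-- Conversely, a left-right ordering yields unit intervals one at a time
-- from the right, since the bounds on the new endpoint never conflict.

module Submission where

open import Defs
open import Data.Fin.Base using (Fin; zero; suc)
import Data.Fin.Properties as Fin
open import Data.List.Base using (List; []; _∷_; [_]; _++_; allFin; filter; last; length; map)
open import Data.List.Membership.Propositional using (_∈_; _∉_)
open import Data.List.Membership.Propositional.Properties
  using (∈-++⁺ˡ; ∈-++⁺ʳ; ∈-++⁻; ∈-∃++; ∈-allFin; ∈-filter⁺; ∈-filter⁻; ∈-map⁻; ∈-map⁺)
open import Data.List.Properties using (++-assoc; ++-identityʳ; length-++-sucʳ)
open import Data.List.Relation.Binary.Sublist.Propositional using (_∷_; _∷ʳ_; to∈; from∈)
open import Data.List.Relation.Binary.Subset.Propositional renaming (_⊆_ to _⊆ˢ_)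
open import Data.List.Relation.Unary.All as All using (All; []; _∷_)
open import Data.List.Relation.Unary.AllPairs as AllPairs using (AllPairs; []; _∷_)
import Data.List.Relation.Unary.AllPairs.Properties as AllPairs
open import Data.List.Relation.Unary.Any using (here; there)
open import Data.List.Relation.Unary.Unique.Propositional using (Unique)
import Data.List.Relation.Unary.Unique.Propositional.Properties as Unique
open import Data.Maybe.Base using (just)
open import Data.Nat.Base as ℕ using (ℕ)
import Data.Nat.Properties as ℕ
open import Data.Product using (_×_; _,_; proj₁; proj₂; ∃-syntax)
open import Data.Rational.Base as ℚ using (ℚ; 0ℚ; 1ℚ; ½; ∣_∣)
import Data.Rational.Properties as ℚ
open import Data.Rational.Solver using (module +-*-Solver)
open import Data.Sum.Base as Sum using (_⊎_; inj₁; inj₂; [_,_]′)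
open import Function.Base using (_∘_; flip; _$_)
open import Function.Bundles using (_⇔_; mk⇔; Equivalence)
open import Level using (0ℓ)
open import Relation.Binary.Core using (Rel)
open import Relation.Binary.Construct.Closure.ReflexiveTransitive as Star using (Star; _◅_)
open import Relation.Binary.Definitions
  using (Total; Transitive; Trichotomous; tri<; tri≈; tri>)
open import Relation.Binary.PropositionalEquality
  using (_≡_; _≢_; refl; sym; trans; cong; subst; subst₂; isEquivalence)
open import Relation.Binary.Structures using (IsStrictTotalOrder)
open import Relation.Binary.Structures.Biased using (isStrictTotalOrderᶜ)
open import Relation.Nullary using (¬_; yes; no; contradiction; decidable-stable; ¬?; _×-dec_)
open Equivalence using (to; from)

private variable
  n : ℕ
  B : Set

-- Lists without repetition and the order of appearance in them.

AllPairs-map-∈ : ∀ {R S : Rel B 0ℓ} {xs} → (∀ {x y} → x ∈ xs → y ∈ xs → R x y → S x y) →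
                 AllPairs R xs → AllPairs S xs
AllPairs-map-∈ f []       = []
AllPairs-map-∈ f (r ∷ rs) =
  All.tabulate (λ y∈ → f (here refl) (there y∈) (All.lookup r y∈))
  ∷ AllPairs-map-∈ (λ x∈ y∈ → f (there x∈) (there y∈)) rs

AllPairs-++⁻ʳ : ∀ {R : Rel B 0ℓ} xs {ys} → AllPairs R (xs ++ ys) → AllPairs R ys
AllPairs-++⁻ʳ []       rs       = rs
AllPairs-++⁻ʳ (_ ∷ xs) (_ ∷ rs) = AllPairs-++⁻ʳ xs rs

last-++ : ∀ xs {y : B} {ys} → last (xs ++ y ∷ ys) ≡ last (y ∷ ys)
last-++ []           = refl
last-++ (_ ∷ [])     = refl
last-++ (_ ∷ x ∷ xs) = last-++ (x ∷ xs)

last∈ : ∀ {x : B} xs → last xs ≡ just x → x ∈ xs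
last∈ (x ∷ [])     refl = here refl
last∈ (_ ∷ y ∷ ys) eq   = there (last∈ (y ∷ ys) eq)

AllPairs-last : ∀ {R : Rel B 0ℓ} {x xs} → AllPairs R xs → last xs ≡ just x →
                ∀ {y} → y ∈ xs → y ≡ x ⊎ R y x
AllPairs-last {xs = _ ∷ []}    _         refl (here refl) = inj₁ refl
AllPairs-last {xs = _ ∷ _ ∷ _} (rs ∷ _)  eq   (here refl) = inj₂ (All.lookup rs (last∈ _ eq))
AllPairs-last {xs = _ ∷ _ ∷ _} (_ ∷ rss) eq   (there y∈)  = AllPairs-last rss eq y∈

unique-⊆-length : ∀ {xs ys : List B} → Unique xs → xs ⊆ˢ ys → length xs ℕ.≤ length ys
unique-⊆-length {xs = []}     _        _   = ℕ.z≤n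
unique-⊆-length {xs = x ∷ xs} (x≢ ∷ u) sub with ∈-∃++ (sub (here refl))
... | as , bs , refl = subst (ℕ.suc (length xs) ℕ.≤_) (sym (length-++-sucʳ as x bs))
  (ℕ.s≤s (unique-⊆-length u λ z∈xs → avoid z∈xs (∈-++⁻ as (sub (there z∈xs)))))
  where
  avoid : ∀ {z} → z ∈ xs → z ∈ as ⊎ z ∈ x ∷ bs → z ∈ as ++ bs
  avoid _    (inj₁ z∈as)         = ∈-++⁺ˡ z∈as
  avoid z∈xs (inj₂ (here refl))  = contradiction refl (All.lookup x≢ z∈xs)
  avoid _    (inj₂ (there z∈bs)) = ∈-++⁺ʳ as z∈bs

precedes-lookup : ∀ {R : Rel (Fin n) 0ℓ} {σ a b} → AllPairs R σ → Precedes σ a b → R a b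
precedes-lookup (_ ∷ rs) (_ ∷ʳ p)   = precedes-lookup rs p
precedes-lookup (r ∷ _)  (refl ∷ p) = All.lookup r (to∈ p)

precedes-total : ∀ {σ : List (Fin n)} {a b} → a ∈ σ → b ∈ σ →
                 a ≡ b ⊎ Precedes σ a b ⊎ Precedes σ b a
precedes-total (here refl) (here refl) = inj₁ refl
precedes-total (here refl) (there b∈)  = inj₂ (inj₁ (refl ∷ from∈ b∈))
precedes-total (there a∈)  (here refl) = inj₂ (inj₂ (refl ∷ from∈ a∈))
precedes-total (there a∈)  (there b∈)  =
  Sum.map₂ (Sum.map (_ ∷ʳ_) (_ ∷ʳ_)) (precedes-total a∈ b∈)

precedes-∈ : ∀ {σ : List (Fin n)} {a b} → Precedes σ a b → a ∈ σ × b ∈ σ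
precedes-∈ (_ ∷ʳ p)   = let a∈ , b∈ = precedes-∈ p in there a∈ , there b∈
precedes-∈ (refl ∷ p) = here refl , there (to∈ p)

-- Without repetition the middle element occurs only once, so the two sublists meet at the same
-- place; a second occurrence is what the contradictory case excludes.
precedes-trans : ∀ {σ : List (Fin n)} → Unique σ → Transitive (Precedes σ)
precedes-trans (_ ∷ u)  (_ ∷ʳ p)   (_ ∷ʳ q)   = _ ∷ʳ precedes-trans u p q
precedes-trans (x≢ ∷ _) (_ ∷ʳ p)   (refl ∷ _) = contradiction refl (All.lookup x≢ (proj₂ (precedes-∈ p)))
precedes-trans _        (refl ∷ _) (_ ∷ʳ q)   = refl ∷ from∈ (proj₂ (precedes-∈ q))
precedes-trans _        (refl ∷ _) (refl ∷ q) = refl ∷ q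

precedes-irrefl : ∀ {σ : List (Fin n)} {a} → Unique σ → ¬ Precedes σ a a
precedes-irrefl u p = precedes-lookup u p refl

precedes-isStrictTotalOrder : ∀ {σ : List (Fin n)} → Unique σ → (∀ v → v ∈ σ) →
                              IsStrictTotalOrder _≡_ (Precedes σ)
precedes-isStrictTotalOrder {σ = σ} u all = isStrictTotalOrderᶜ record
  { isEquivalence = isEquivalence
  ; trans         = precedes-trans u
  ; compare       = compare
  }
  where
  irr : ∀ {a} → ¬ Precedes σ a a
  irr = precedes-irrefl u

  compare : Trichotomous _≡_ (Precedes σ)
  compare a b with precedes-total (all a) (all b)
  ... | inj₁ refl       = tri≈ irr refl irr
  ... | inj₂ (inj₁ a<b) = tri< a<b (λ { refl → irr a<b }) (λ b<a → irr (precedes-trans u a<b b<a))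
  ... | inj₂ (inj₂ b<a) = tri> (λ a<b → irr (precedes-trans u a<b b<a)) (λ { refl → irr b<a }) b<a

-- Closed neighbourhoods and invariants of breadth first search.

module Search {n} (G : Graph n) where
  open import Data.List.Membership.DecPropositional (Fin._≟_ {n}) using (_∈?_)
  open Graph G hiding (Connected) renaming (sym to Adj-sym)

  infix 4 _~_ _⊴_

  -- With closed neighbourhoods, the left-right condition makes sense for
  -- weak orders, where distinct vertices may be tied.
  _~_ : Rel (Fin n) 0ℓ
  u ~ v = u ≡ v ⊎ Adj u v

  ~-sym : ∀ {u v} → u ~ v → v ~ u
  ~-sym = Sum.map sym Adj-sym

  ~⇒Adj : ∀ {u v} → u ≢ v → u ~ v → Adj u v
  ~⇒Adj u≢v = [ (λ u≡v → contradiction u≡v u≢v) , (λ uv → uv) ]′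

  -- Inclusion of closed neighbourhoods; twins are the pairs related in both directions.
  _⊴_ : Rel (Fin n) 0ℓ
  u ⊴ v = ∀ {z} → u ~ z → v ~ z

  neighbours : Fin n → List (Fin n)
  neighbours v = filter (adj? v) (allFin n)

  ∈-neighbours⁺ : ∀ {v z} → v ~ z → z ∈ v ∷ neighbours v
  ∈-neighbours⁺ (inj₁ refl) = here refl
  ∈-neighbours⁺ (inj₂ vz)   = there (∈-filter⁺ (adj? _) (∈-allFin _) vz)

  ∈-neighbours⁻ : ∀ {v z} → z ∈ v ∷ neighbours v → v ~ z
  ∈-neighbours⁻ (here refl) = inj₁ refl
  ∈-neighbours⁻ {v} (there z∈)  = inj₂ (proj₂ (∈-filter⁻ (adj? v) {xs = allFin n} z∈))

  neighbours-unique : ∀ v → Unique (v ∷ neighbours v)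
  neighbours-unique v =
    All.tabulate (λ { z∈ refl → irrefl v (proj₂ (∈-filter⁻ (adj? v) {xs = allFin n} z∈)) })
    ∷ Unique.filter⁺ (adj? v) (Unique.allFin⁺ n)

  -- Pigeonhole: a `z` in N[x] but not in N[y], put in front of N[y], would give a list without
  -- repetition inside N[x] that is longer than N[y], so `x` would have the larger degree.
  ⊴-degree : ∀ {x y} → y ⊴ x → degree x ℕ.≤ degree y → x ⊴ y
  ⊴-degree {x} {y} y⊴x dx≤dy {z} x~z with z ∈? (y ∷ neighbours y)
  ... | yes z∈ = ∈-neighbours⁻ z∈
  ... | no z∉  = contradiction dx≤dy (ℕ.<⇒≱ (ℕ.s≤s⁻¹ (unique-⊆-length
    (All.tabulate (λ { w∈ refl → z∉ w∈ }) ∷ neighbours-unique y)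
    λ { (here refl) → ∈-neighbours⁺ x~z
      ; (there w∈)  → ∈-neighbours⁺ (y⊴x (∈-neighbours⁻ w∈)) })))

  Children : Fin n → (discovered ns : List (Fin n)) → Set
  Children v D ns = ∀ w → w ∈ ns ⇔ (Adj v w × w ∉ D)

  children-complete : ∀ {v D ns z} → Children v D ns → v ∈ D → v ~ z → z ∈ D ++ ns
  children-complete ch v∈D (inj₁ refl) = ∈-++⁺ˡ v∈D
  children-complete {D = D} {z = z} ch v∈D (inj₂ vz) with z ∈? D
  ... | yes z∈D = ∈-++⁺ˡ z∈D
  ... | no z∉D  = ∈-++⁺ʳ D (from (ch _) (vz , z∉D))

  -- The discovered list is always the visited vertices followed by the
  -- queue, so at the end it is the visiting order itself.
  run-invariant : ∀ {_≽_ : Rel (Fin n) 0ℓ} (I : (visited discovered : List (Fin n)) → Set) →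
    (∀ {P v Q ns} (let D = P ++ v ∷ Q) → Unique ns → Children v D ns → AllPairs _≽_ ns →
       I P D → I (P ++ [ v ]) (D ++ ns)) →
    ∀ {P Q D σ} → D ≡ P ++ Q → Run G _≽_ Q D σ → I P D → I (P ++ σ) (P ++ σ)
  run-invariant I stp {P} refl done i = subst (λ V → I V (P ++ [])) (sym (++-identityʳ P)) i
  run-invariant I stp {P} refl (step {v} {Q} {σ = σ} ns u ch s run) i =
    subst (λ τ → I τ τ) (++-assoc P [ v ] σ)
      (run-invariant I stp
        (trans (++-assoc P (v ∷ Q) ns) (sym (++-assoc P [ v ] (Q ++ ns))))
        run (stp u ch s i))

  Closed : (visited discovered : List (Fin n)) → Set
  Closed P D = ∀ {p z} → p ∈ P → p ~ z → z ∈ D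

  closed-step : ∀ {P v Q ns} (let D = P ++ v ∷ Q) → Children v D ns → Closed P D →
                Closed (P ++ [ v ]) (D ++ ns)
  closed-step {P} ch cl p∈ p~z with ∈-++⁻ P p∈
  ... | inj₁ p∈P         = ∈-++⁺ˡ (cl p∈P p~z)
  ... | inj₂ (here refl) = children-complete ch (∈-++⁺ʳ P (here refl)) p~z

  module _ {_≽_ : Rel (Fin n) 0ℓ} {s : Fin n} {σ : List (Fin n)} (run : BFS G _≽_ s σ) where

    bfs-unique : Unique σ
    bfs-unique = run-invariant (λ _ → Unique)
      (λ {P} u ch _ uD → Unique.++⁺ uD u λ (z∈D , z∈ns) → proj₂ (to (ch _) z∈ns) z∈D)
      {P = []} refl run ([] ∷ [])

    -- At the end everything discovered has been visited, so `Closed σ σ` says that `σ` is closed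
    -- under adjacency; it contains `s`, and paths from `s` reach every vertex.
    bfs-complete : Connected G → ∀ v → v ∈ σ
    bfs-complete conn v = reach (proj₁ inv) (conn s v)
      where
      inv : s ∈ σ × Closed σ σ
      inv = run-invariant (λ P D → s ∈ D × Closed P D)
        (λ _ ch _ (s∈D , cl) → ∈-++⁺ˡ s∈D , closed-step ch cl)
        {P = []} refl run (here refl , λ ())

      reach : ∀ {a b} → a ∈ σ → Star Adj a b → b ∈ σ
      reach a∈ Star.ε   = a∈
      reach a∈ (e ◅ es) = reach (proj₂ inv a∈ (inj₂ e)) es

  -- Weak left-right orders and the tying of twins.

  record WeakLeftRight (_≼_ : Rel (Fin n) 0ℓ) : Set where
    field
      total     : Total _≼_
      ≼-trans   : Transitive _≼_
      leftRight : ∀ {u v w} → u ≼ v → v ≼ w → u ~ w → u ~ v × v ~ w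

    ≼-refl : ∀ {x} → x ≼ x
    ≼-refl {x} = [ (λ p → p) , (λ p → p) ]′ (total x x)

    -- Pass 1 may finish at either end of the order; reversal reduces each argument to one end.
    dual : WeakLeftRight (flip _≼_)
    dual = record
      { total     = λ x y → total y x
      ; ≼-trans   = λ p q → ≼-trans q p
      ; leftRight = λ p q u~w → let r , s = leftRight q p (~-sym u~w) in ~-sym s , ~-sym r
      }

  -- Twins have equal degree, so a search may visit them in either order, and its output can be
  -- sorted only for an order that does not separate them.
  TwinsTied : Rel (Fin n) 0ℓ → Set
  TwinsTied _≼_ = ∀ {x y} → x ⊴ y → y ⊴ x → x ≼ y

  module TwinClosure {_≼_ : Rel (Fin n) 0ℓ} (W : WeakLeftRight _≼_) where
    open WeakLeftRight W

    infix 4 _⊑_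

    _⊑_ : Rel (Fin n) 0ℓ
    x ⊑ y = x ≼ y ⊎ (x ⊴ y × y ⊴ x)

    -- For a neighbour of `a`, compare its position with `b` and `c`: beyond `b` or between the two,
    -- `leftRight` makes it adjacent to `b` directly; before `c`, it is adjacent to `c` and hence to
    -- the twin `b`. The other inclusion is similar.
    twins-convex : ∀ {c a b} → c ≼ a → a ≼ b → b ⊴ c → c ⊴ b → a ⊴ b × b ⊴ a
    twins-convex {c} {a} {b} c≼a a≼b b⊴c c⊴b = a⊴b , b⊴a
      where
      a⊴b : a ⊴ b
      a⊴b {z} a~z with total z b | total z c
      ... | inj₂ b≼z | _        = proj₂ (leftRight a≼b b≼z a~z)
      ... | inj₁ z≼b | inj₂ c≼z = ~-sym (proj₂ (leftRight c≼z z≼b (b⊴c (inj₁ refl))))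
      ... | inj₁ z≼b | inj₁ z≼c = c⊴b (~-sym (proj₁ (leftRight z≼c c≼a (~-sym a~z))))

      b⊴a : b ⊴ a
      b⊴a {z} b~z with total z a
      ... | inj₁ z≼a = ~-sym (proj₁ (leftRight z≼a a≼b (~-sym b~z)))
      ... | inj₂ a≼z = proj₂ (leftRight c≼a a≼z (b⊴c b~z))

    twinClosure : WeakLeftRight _⊑_
    twinClosure = record { total = tot ; ≼-trans = tr ; leftRight = lr }
      where
      tot : Total _⊑_
      tot x y = Sum.map inj₁ inj₁ (total x y)

      tr : Transitive _⊑_
      tr (inj₁ a≼b) (inj₁ b≼c) = inj₁ (≼-trans a≼b b≼c)
      tr (inj₂ (a⊴b , b⊴a)) (inj₂ (b⊴c , c⊴b)) = inj₂ ((λ p → b⊴c (a⊴b p)) , (λ p → b⊴a (c⊴b p)))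
      -- If `c` comes before `a`, then `a` lies between the twins `c` and `b`, hence is a twin of
      -- both.
      tr {a} {b} {c} (inj₁ a≼b) (inj₂ (b⊴c , c⊴b)) with total a c
      ... | inj₁ a≼c = inj₁ a≼c
      ... | inj₂ c≼a = let a⊴b , b⊴a = twins-convex c≼a a≼b b⊴c c⊴b in
                       inj₂ ((λ p → b⊴c (a⊴b p)) , (λ p → b⊴a (c⊴b p)))
      tr {a} {b} {c} (inj₂ (a⊴b , b⊴a)) (inj₁ b≼c) with total a c
      ... | inj₁ a≼c = inj₁ a≼c
      ... | inj₂ c≼a = let c⊴a , a⊴c = twins-convex b≼c c≼a a⊴b b⊴a in inj₂ (a⊴c , c⊴a)

      lr : ∀ {u v w} → u ⊑ v → v ⊑ w → u ~ w → u ~ v × v ~ w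
      lr (inj₁ u≼v)         (inj₁ v≼w)         u~w = leftRight u≼v v≼w u~w
      lr (inj₂ (u⊴v , v⊴u)) _                  u~w = v⊴u (inj₁ refl) , u⊴v u~w
      lr (inj₁ _)           (inj₂ (v⊴w , w⊴v)) u~w = ~-sym (w⊴v (~-sym u~w)) , ~-sym (v⊴w (inj₁ refl))

    twinClosure-tied : TwinsTied _⊑_
    twinClosure-tied x⊴y y⊴x = inj₂ (x⊴y , y⊴x)

  -- Ties with the endpoints are allowed for the sake of D = [ s ].
  Convex : Rel (Fin n) 0ℓ → List (Fin n) → Set
  Convex _≼_ D = ∀ {a b c} → a ∈ D → c ∈ D → b ∉ D → a ≼ b → b ≼ c → c ≼ a

  -- Invariants of the two passes.

  module Sweep {_≼_ : Rel (Fin n) 0ℓ} (W : WeakLeftRight _≼_) (tied : TwinsTied _≼_) where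
    open WeakLeftRight W

    -- If an endpoint is a new child, then `leftRight` applied to `v`, `b` and that child would make
    -- `b` a neighbour of `v`, which is by now discovered. So only old endpoints remain.
    convex-step : ∀ {v D ns} → Children v D ns → v ∈ D → Convex _≼_ D → Convex _≼_ (D ++ ns)
    convex-step {v} {D} {ns} ch v∈D conv {a} {b} {c} a∈ c∈ b∉ a≼b b≼c =
      go (∈-++⁻ D a∈) (∈-++⁻ D c∈) (total b v)
      where
      b≁v : ¬ v ~ b
      b≁v v~b = b∉ (children-complete ch v∈D v~b)

      b∉D : b ∉ D
      b∉D = b∉ ∘ ∈-++⁺ˡ

      child : ∀ {x} → x ∈ ns → v ~ x
      child x∈ = inj₂ (proj₁ (to (ch _) x∈))

      go : a ∈ D ⊎ a ∈ ns → c ∈ D ⊎ c ∈ ns → b ≼ v ⊎ v ≼ b → c ≼ a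
      go (inj₁ a∈D)  (inj₁ c∈D)  _          = conv a∈D c∈D b∉D a≼b b≼c
      go _           (inj₂ c∈ns) (inj₂ v≼b) = contradiction (proj₁ (leftRight v≼b b≼c (child c∈ns))) b≁v
      go (inj₂ a∈ns) _           (inj₁ b≼v) =
        contradiction (~-sym (proj₂ (leftRight a≼b b≼v (~-sym (child a∈ns))))) b≁v
      -- Here `v` and `c` seem to be on the same side of `b`, but convexity of `D` ties `a`, `b` and
      -- `v`, so `v` also counts as lying before `b`.
      go (inj₁ a∈D)  (inj₂ c∈ns) (inj₁ b≼v) =
        let v≼a = conv a∈D v∈D b∉D a≼b b≼v in
        contradiction (proj₁ (leftRight (≼-trans v≼a a≼b) b≼c (child c∈ns))) b≁v
      go (inj₂ a∈ns) (inj₁ c∈D)  (inj₂ v≼b) =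
        let c≼v = conv v∈D c∈D b∉D v≼b b≼c in
        contradiction (~-sym (proj₂ (leftRight a≼b (≼-trans b≼c c≼v) (~-sym (child a∈ns))))) b≁v

    -- Among the children of v lying after v, the closed neighbourhoods
    -- shrink towards the end of the order, so the one of least degree is
    -- a twin of the last.
    least-child-greatest : ∀ {v r D} → Convex _≼_ D → v ∈ D → r ∉ D → v ~ r → v ≼ r →
      (∀ z → z ∈ D ⊎ (v ~ z × degree r ℕ.≤ degree z)) → ∀ z → z ≼ r
    least-child-greatest {v} {r} conv v∈D r∉D v~r v≼r cover z with total z r
    ... | inj₁ z≼r = z≼r
    ... | inj₂ r≼z with cover z
    -- An old vertex beyond the new `r` is tied with `v` by convexity, and so with `r`.
    ...   | inj₁ z∈D         = ≼-trans (conv v∈D z∈D r∉D v≼r r≼z) v≼r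
    ...   | inj₂ (_ , dr≤dz) = tied z⊴r (⊴-degree z⊴r dr≤dz)
      where
      before : ∀ {y} → y ≼ r → z ~ y → r ~ y
      before y≼r z~y = ~-sym (proj₁ (leftRight y≼r r≼z (~-sym z~y)))

      z⊴r : z ⊴ r
      z⊴r {y} z~y with total y r
      ... | inj₁ y≼r = before y≼r z~y
      ... | inj₂ r≼y with cover y
      ...   | inj₁ y∈D       = before (≼-trans (conv v∈D y∈D r∉D v≼r r≼y) v≼r) z~y
      ...   | inj₂ (v~y , _) = proj₂ (leftRight v≼r r≼y v~y)

    -- Invariant of pass 2. `initial` places new children after all old vertices, and `closed` keeps
    -- visited vertices out of the neighbourhoods of the new children when these are compared.
    record Sorted (P D : List (Fin n)) : Set where
      field
        sorted  : AllPairs _≼_ D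
        initial : ∀ {d w} → d ∈ D → w ∉ D → d ≼ w
        closed  : Closed P D

    sorted-step : ∀ {P v Q ns} (let D = P ++ v ∷ Q) → Children v D ns →
      AllPairs (λ u w → degree u ℕ.≤ degree w) ns → Sorted P D → Sorted (P ++ [ v ]) (D ++ ns)
    sorted-step {P} {v} {Q} {ns} ch deg inv = record
      { sorted  = AllPairs.++⁺ sorted (AllPairs-map-∈ smaller-degree deg)
                    (All.tabulate λ d∈ → All.tabulate λ z∈ → initial d∈ (proj₂ (child z∈)))
      ; initial = λ d∈ w∉ → initial′ (∈-++⁻ D d∈) w∉
      ; closed  = closed-step ch closed
      }
      where
      open Sorted inv

      D : List (Fin n)
      D = P ++ v ∷ Q

      child : ∀ {z} → z ∈ ns → v ~ z × z ∉ D
      child z∈ = let vz , z∉D = to (ch _) z∈ in inj₂ vz , z∉D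

      v∈D : v ∈ D
      v∈D = ∈-++⁺ʳ P (here refl)

      -- The vertex `v` heads the queue: the rest of the queue follows it because `D` is sorted, the
      -- undiscovered vertices because `D` is an initial segment.
      unvisited : ∀ z → z ∈ P ⊎ v ≼ z
      unvisited z with z ∈? D
      ... | no z∉D = inj₂ (initial v∈D z∉D)
      ... | yes z∈D with ∈-++⁻ P z∈D | AllPairs-++⁻ʳ P sorted
      ...   | inj₁ z∈P         | _        = inj₁ z∈P
      ...   | inj₂ (here refl) | _        = inj₂ ≼-refl
      ...   | inj₂ (there z∈Q) | v≼Q ∷ _  = inj₂ (All.lookup v≼Q z∈Q)

      smaller-degree : ∀ {x y} → x ∈ ns → y ∈ ns → degree x ℕ.≤ degree y → x ≼ y
      smaller-degree {x} {y} x∈ y∈ dx≤dy with total x y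
      ... | inj₁ x≼y = x≼y
      ... | inj₂ y≼x = tied (⊴-degree y⊴x dx≤dy) y⊴x
        where
        -- A neighbour `z` of `y` is not visited, or `y` would have been discovered, so `z` does not
        -- lie before `v`. Up to `x` it is caught by the edge from `v` to `x`, beyond `x` by the
        -- edge from `y` to `z`.
        y⊴x : y ⊴ x
        y⊴x {z} y~z with unvisited z | total z x
        ... | inj₁ z∈P | _        = contradiction (closed z∈P (~-sym y~z)) (proj₂ (child y∈))
        ... | inj₂ v≼z | inj₁ z≼x = ~-sym (proj₂ (leftRight v≼z z≼x (proj₁ (child x∈))))
        ... | inj₂ v≼z | inj₂ x≼z = proj₂ (leftRight y≼x x≼z y~z)

      initial′ : ∀ {d w} → d ∈ D ⊎ d ∈ ns → w ∉ D ++ ns → d ≼ w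
      initial′ (inj₁ d∈D) w∉ = initial d∈D (w∉ ∘ ∈-++⁺ˡ)
      initial′ {d} {w} (inj₂ d∈ns) w∉ with total d w
      ... | inj₁ d≼w = d≼w
      -- Then `w` lies between `v` and its child `d`, so `w` is itself discovered in this step.
      ... | inj₂ w≼d = contradiction
        (children-complete ch v∈D
          (proj₁ (leftRight (initial v∈D (w∉ ∘ ∈-++⁺ˡ)) w≼d (proj₁ (child d∈ns)))))
        w∉

    minBFS-sorted : ∀ {r σ} → (∀ z → r ≼ z) → MinBFS G r σ → AllPairs _≼_ σ
    minBFS-sorted least run = Sorted.sorted $ run-invariant Sorted
      (λ _ → sorted-step) {P = []} refl run record
      { sorted  = [] ∷ []
      ; initial = λ { (here refl) _ → least _ }
      ; closed  = λ ()
      }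

  module TwoSweeps {_≼_ : Rel (Fin n) 0ℓ} (W : WeakLeftRight _≼_) (tied : TwinsTied _≼_) where
    open WeakLeftRight W

    private
      module Forward  = Sweep W tied
      module Backward = Sweep dual (λ x⊴y y⊴x → tied y⊴x x⊴y)

    Extreme : Fin n → Set
    Extreme r = (∀ z → z ≼ r) ⊎ (∀ z → r ≼ z)

    -- Restricted to complete lists, because the last vertex discovered midway through the search
    -- may well be an inner one.
    LastExtreme : List (Fin n) → Set
    LastExtreme D = ∀ {r} → last D ≡ just r → (∀ z → z ∈ D) → Extreme r

    lastExtreme-step : ∀ {v D ns} → Children v D ns → v ∈ D → Convex _≼_ D →
      AllPairs (λ u w → degree u ℕ.≥ degree w) ns → LastExtreme D → LastExtreme (D ++ ns)
    -- Without new children the last vertex is unchanged; otherwise it is the last child, which has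
    -- least degree among its siblings.
    lastExtreme-step {D = D} {[]} _ _ _ _ ext rewrite ++-identityʳ D = ext
    lastExtreme-step {v} {D} {ns@(_ ∷ _)} ch v∈D conv deg _ {r} last≡r full = extreme
      where
      last≡r′ : last ns ≡ just r
      last≡r′ = trans (sym (last-++ D)) last≡r

      v~r : Adj v r × r ∉ D
      v~r = to (ch r) (last∈ ns last≡r′)

      cover : ∀ z → z ∈ D ⊎ (v ~ z × degree r ℕ.≤ degree z)
      cover z with ∈-++⁻ D (full z)
      ... | inj₁ z∈D  = inj₁ z∈D
      ... | inj₂ z∈ns = inj₂ (inj₂ (proj₁ (to (ch z) z∈ns)) ,
        [ (λ { refl → ℕ.≤-refl }) , (λ d → d) ]′ (AllPairs-last deg last≡r′ z∈ns))

      extreme : Extreme r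
      extreme with total v r
      ... | inj₁ v≼r = inj₁ (Forward.least-child-greatest conv v∈D (proj₂ v~r) (inj₂ (proj₁ v~r)) v≼r cover)
      ... | inj₂ r≼v = inj₂ (Backward.least-child-greatest (λ a∈ c∈ b∉ a≽b b≽c → conv c∈ a∈ b∉ b≽c a≽b)
                               v∈D (proj₂ v~r) (inj₂ (proj₁ v~r)) r≼v cover)

    maxBFS-lastExtreme : ∀ {s τ} → MaxBFS G s τ → LastExtreme τ
    maxBFS-lastExtreme run = proj₂ $ run-invariant (λ _ D → Convex _≼_ D × LastExtreme D)
      (λ {P} _ ch deg (conv , ext) → let v∈D = ∈-++⁺ʳ P (here refl) in
         Forward.convex-step ch v∈D conv , lastExtreme-step ch v∈D conv deg ext)
      {P = []} refl run
      ( (λ { (here refl) (here refl) _ _ _ → ≼-refl })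
      , (λ { refl full → inj₁ λ z → singleton (full z) }))
      where
      singleton : ∀ {z s} → z ∈ [ s ] → z ≼ s
      singleton (here refl) = ≼-refl

    sorted-leftRight : ∀ {σ} → Unique σ → AllPairs _≼_ σ → ∀ {a b c} →
      Precedes σ a b → Precedes σ b c → Adj a c → Adj a b × Adj b c
    sorted-leftRight u srt a<b b<c ac =
      let a~b , b~c = leftRight (precedes-lookup srt a<b) (precedes-lookup srt b<c) (inj₂ ac) in
      ~⇒Adj (precedes-lookup u a<b) a~b , ~⇒Adj (precedes-lookup u b<c) b~c

  -- The conclusion does not mention the order, so it may be coarsened to its twin closure and, if
  -- pass 1 ends at a greatest vertex, reversed.
  twoPass-leftRight : ∀ {_≼_ σ} → WeakLeftRight _≼_ → Connected G → TwoPass G σ → ∀ {a b c} →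
    Precedes σ a b → Precedes σ b c → Adj a c → Adj a b × Adj b c
  twoPass-leftRight {σ = σ} W conn tp = cases (maxBFS-lastExtreme pass₁ r-last (bfs-complete pass₁ conn))
    where
    open TwoPass tp
    open TwinClosure W
    open TwoSweeps twinClosure twinClosure-tied
    dual-tied : TwinsTied (flip _⊑_)
    dual-tied x⊴y y⊴x = twinClosure-tied y⊴x x⊴y

    cases : Extreme r → ∀ {a b c} → Precedes σ a b → Precedes σ b c → Adj a c → Adj a b × Adj b c
    cases (inj₂ least) =
      sorted-leftRight (bfs-unique pass₂) (Sweep.minBFS-sorted twinClosure twinClosure-tied least pass₂)
    cases (inj₁ greatest) =
      TwoSweeps.sorted-leftRight (WeakLeftRight.dual twinClosure) dual-tied (bfs-unique pass₂)
        (Sweep.minBFS-sorted (WeakLeftRight.dual twinClosure) dual-tied greatest pass₂)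

-- Order on the reals and intersection of intervals.

p≤∣p∣ : ∀ p → p ℚ.≤ ∣ p ∣
p≤∣p∣ p with ℚ.≤-total 0ℚ p
... | inj₁ 0≤p = ℚ.≤-reflexive (sym (ℚ.0≤p⇒∣p∣≡p 0≤p))
... | inj₂ p≤0 = ℚ.≤-trans p≤0 (ℚ.0≤∣p∣ p)

p≤p+ε : ∀ p {ε} → 0ℚ ℚ.< ε → p ℚ.≤ p ℚ.+ ε
p≤p+ε p {ε} 0<ε = subst (ℚ._≤ p ℚ.+ ε) (ℚ.+-identityʳ p) (ℚ.+-monoʳ-≤ p (ℚ.<⇒≤ 0<ε))

p-q<r⇒p<r+q : ∀ {p q r} → p ℚ.- q ℚ.< r → p ℚ.< r ℚ.+ q
p-q<r⇒p<r+q {p} {q} {r} p-q<r = subst (ℚ._< r ℚ.+ q)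
  (solve 2 (λ p q → (p :- q) :+ q := p) refl p q)
  (ℚ.+-monoˡ-< q p-q<r)
  where open +-*-Solver

0<½ε : ∀ {ε} → 0ℚ ℚ.< ε → 0ℚ ℚ.< ½ ℚ.* ε
0<½ε {ε} 0<ε = subst (ℚ._< ½ ℚ.* ε) (ℚ.*-zeroʳ ½) (ℚ.*-monoʳ-<-pos ½ 0<ε)

pointwise-≤ : ∀ {x y} → (∀ m → seq x m ℚ.≤ seq y m) → x ≤ᴿ y
pointwise-≤ x≤y ε 0<ε = 0 , λ m _ → ℚ.≤-trans (x≤y m) (p≤p+ε _ 0<ε)

≤ᴿ-refl : ∀ {x} → x ≤ᴿ x
≤ᴿ-refl {x} = pointwise-≤ {x} {x} λ _ → ℚ.≤-refl

≤ᴿ-trans : ∀ {x y z} → x ≤ᴿ y → y ≤ᴿ z → x ≤ᴿ z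
≤ᴿ-trans {x} {y} {z} x≤y y≤z ε 0<ε with x≤y (½ ℚ.* ε) (0<½ε 0<ε) | y≤z (½ ℚ.* ε) (0<½ε 0<ε)
... | M , p | N , q = M ℕ.⊔ N , λ m M⊔N≤m →
  subst (seq x m ℚ.≤_) (halves (seq z m) ε)
    (ℚ.≤-trans (p m (ℕ.m⊔n≤o⇒m≤o M N M⊔N≤m))
      (ℚ.+-monoˡ-≤ (½ ℚ.* ε) (q m (ℕ.m⊔n≤o⇒n≤o M N M⊔N≤m))))
  where
  open +-*-Solver
  halves : ∀ c ε → (c ℚ.+ ½ ℚ.* ε) ℚ.+ ½ ℚ.* ε ≡ c ℚ.+ ε
  halves = solve 2 (λ c ε → (c :+ con ½ :* ε) :+ con ½ :* ε := c :+ ε) refl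

-- Choose `N` past which `x -ᴿ y` varies by less than `ε`. If some later term of `x` were more than
-- `ε` below that of `y`, then all terms past `N` would be below, giving the excluded inequality.
≰ᴿ⇒≥ᴿ : ∀ {x y} → ¬ x ≤ᴿ y → y ≤ᴿ x
≰ᴿ⇒≥ᴿ {x} {y} x≰y ε 0<ε = let N , close = cauchy (x -ᴿ y) ε 0<ε in
  N , λ m N≤m → ℚ.≮⇒≥ λ xₘ+ε<yₘ → x≰y λ δ 0<δ → N , λ k N≤k →
  ℚ.≤-trans
    (ℚ.<⇒≤ (below (seq x k) (seq y k) (seq x m) (seq y m) xₘ+ε<yₘ
      (ℚ.≤-<-trans (p≤∣p∣ _) (close k m N≤k N≤m))))
    (p≤p+ε _ 0<δ)
  where
  below : ∀ a b c d → c ℚ.+ ε ℚ.< d → (a ℚ.- b) ℚ.- (c ℚ.- d) ℚ.< ε → a ℚ.< b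
  below a b c d c+ε<d lt =
    subst (a ℚ.<_) (ℚ.+-identityˡ b) (ℚ.<-trans (p-q<r⇒p<r+q (p-q<r⇒p<r+q lt)) (ℚ.+-monoˡ-< b ε+c-d<0))
    where
    open +-*-Solver

    ε+c-d<0 : ε ℚ.+ (c ℚ.- d) ℚ.< 0ℚ
    ε+c-d<0 = subst₂ ℚ._<_
      (solve 3 (λ c d e → (c :+ e) :- d := e :+ (c :- d)) refl c d ε)
      (ℚ.+-inverseʳ d)
      (ℚ.+-monoˡ-< (ℚ.- d) c+ε<d)

≤ᴿ-total : ∀ x y → ¬ ¬ (x ≤ᴿ y ⊎ y ≤ᴿ x)
≤ᴿ-total x y k = k (inj₂ (≰ᴿ⇒≥ᴿ {x} {y} (k ∘ inj₁)))

lo-width-≤ : ∀ I J → lo I ≤ᴿ lo J → width I ≤ᴿ width J → hi I ≤ᴿ hi J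
lo-width-≤ I J lo≤ width≤ ε 0<ε with lo≤ (½ ℚ.* ε) (0<½ε 0<ε) | width≤ (½ ℚ.* ε) (0<½ε 0<ε)
... | M , p | N , q = M ℕ.⊔ N , λ m M⊔N≤m → subst₂ ℚ._≤_
  (solve 2 (λ l h → l :+ (h :- l) := h) refl (seq (lo I) m) (seq (hi I) m))
  (solve 3 (λ l h e → (l :+ con ½ :* e) :+ ((h :- l) :+ con ½ :* e) := h :+ e) refl
    (seq (lo J) m) (seq (hi J) m) ε)
  (ℚ.+-mono-≤ (p m (ℕ.m⊔n≤o⇒m≤o M N M⊔N≤m)) (q m (ℕ.m⊔n≤o⇒n≤o M N M⊔N≤m)))
  where open +-*-Solver

intersect-sym : ∀ {I J} → Intersect I J → Intersect J I
intersect-sym (p , p∈I , p∈J) = p , p∈J , p∈I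

intersect⁺ : ∀ {I J} → lo I ≤ᴿ lo J → lo J ≤ᴿ hi I → Intersect I J
intersect⁺ {I} {J} loI≤loJ loJ≤hiI =
  lo J , (loI≤loJ , loJ≤hiI) , (≤ᴿ-refl {lo J} , lo≤hi J)

intersect⁻ : ∀ {I J} → Intersect I J → lo J ≤ᴿ hi I
intersect⁻ {I} {J} (p , (_ , p≤hiI) , (loJ≤p , _)) = ≤ᴿ-trans {lo J} {p} {hi I} loJ≤p p≤hiI

-- Finiteness of the index set allows induction. This lets all comparisons of left endpoints be
-- assumed at once.
¬¬-∀ : ∀ {P : Fin n → Set} → (∀ i → ¬ ¬ P i) → ¬ ¬ (∀ i → P i)
¬¬-∀ {ℕ.zero}  _   k = k λ ()
¬¬-∀ {ℕ.suc n} nnp k = nnp zero λ p₀ → ¬¬-∀ (nnp ∘ suc) λ ps → k (Fin.∀-cons p₀ ps)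

-- From unit intervals to left-right orderings.

module _ {n} (G : Graph n) where
  open Graph G hiding (Connected) renaming (sym to Adj-sym)
  open Search G

  -- Totality is a hypothesis because the order on ℝ is total only up to
  -- double negation.
  uig-weakLeftRight : ((I , _) : UnitIntervalGraph G) →
    (∀ u v → lo (I u) ≤ᴿ lo (I v) ⊎ lo (I v) ≤ᴿ lo (I u)) →
    WeakLeftRight (λ u v → lo (I u) ≤ᴿ lo (I v))
  uig-weakLeftRight (I , equal , model) tot = record
    { total     = tot
    ; ≼-trans   = λ {u} {v} {w} → ≤ᴿ-trans {lo (I u)} {lo (I v)} {lo (I w)}
    ; leftRight = lr
    }
    where
    reach : ∀ {u v} → u ~ v → lo (I v) ≤ᴿ hi (I u)
    reach {u} (inj₁ refl) = lo≤hi (I u)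
    reach {u} {v} (inj₂ uv) with u Fin.≟ v
    ... | yes refl = lo≤hi (I u)
    ... | no u≢v   = intersect⁻ {I u} {I v} (to (model u v u≢v) uv)

    near : ∀ {u v} → lo (I u) ≤ᴿ lo (I v) → lo (I v) ≤ᴿ hi (I u) → u ~ v
    near {u} {v} u≤v v≤u with u Fin.≟ v
    ... | yes u≡v = inj₁ u≡v
    ... | no u≢v  = inj₂ (from (model u v u≢v) (intersect⁺ {I u} {I v} u≤v v≤u))

    lr : ∀ {u v w} → lo (I u) ≤ᴿ lo (I v) → lo (I v) ≤ᴿ lo (I w) → u ~ w → u ~ v × v ~ w
    lr {u} {v} {w} u≤v v≤w u~w =
      near u≤v (≤ᴿ-trans {lo (I v)} {lo (I w)} {hi (I u)} v≤w (reach u~w)) ,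
      -- Equal widths order the right endpoints like the left ones, so `I v` reaches at least as far
      -- as `I u`.
      near v≤w (≤ᴿ-trans {lo (I w)} {hi (I u)} {hi (I v)} (reach u~w)
        (lo-width-≤ (I u) (I v) u≤v (proj₁ (equal u v))))

  uig⇒leftRight : ∀ {σ} → Connected G → TwoPass G σ → UnitIntervalGraph G →
                  IsLeftRightOrdering G (Precedes σ)
  uig⇒leftRight conn tp uig@(I , _) = record
    { isStrictTotalOrder = precedes-isStrictTotalOrder (bfs-unique pass₂) (bfs-complete pass₂ conn)
    -- Adjacency is decidable, so the goal is stable under double negation and totality of the order
    -- on the left endpoints may be assumed.
    ; leftRight = λ {a} {b} {c} a<b b<c ac → decidable-stable (adj? a b ×-dec adj? b c) λ k →
        ¬¬-∀ (λ u → ¬¬-∀ (λ v → ≤ᴿ-total (lo (I u)) (lo (I v)))) λ tot →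
        k (twoPass-leftRight (uig-weakLeftRight uig tot) conn tp a<b b<c ac)
    }
    where open TwoPass tp

-- Rational constants and interpolation between finite sets.

const : ℚ → ℝ
const q = mkℝ (λ _ → q) λ ε 0<ε → 0 , λ _ _ _ _ →
  subst (ℚ._< ε) (sym (cong ∣_∣ (ℚ.+-inverseʳ q))) 0<ε

const-mono-≤ : ∀ {p q} → p ℚ.≤ q → const p ≤ᴿ const q
const-mono-≤ {p} {q} p≤q = pointwise-≤ {const p} {const q} λ _ → p≤q

const-cancel-≤ : ∀ {p q} → const p ≤ᴿ const q → p ℚ.≤ q
const-cancel-≤ {p} {q} p≤q = ℚ.≮⇒≥ λ q<p → let m , q<m , m<p = ℚ.<-dense q<p in
  -- The slack `m - q` yields `p ≤ m`, against `m < p`.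
  let N , le = p≤q (m ℚ.- q) (subst (ℚ._< m ℚ.- q) (ℚ.+-inverseʳ q) (ℚ.+-monoˡ-< (ℚ.- q) q<m)) in
  ℚ.<-irrefl refl (ℚ.<-≤-trans m<p (subst (p ℚ.≤_) (solve 2 (λ m q → q :+ (m :- q) := m) refl m q) (le N ℕ.≤-refl)))
  where open +-*-Solver

pred< : ∀ p → p ℚ.- 1ℚ ℚ.< p
pred< p = subst (p ℚ.- 1ℚ ℚ.<_) (ℚ.+-identityʳ p)
  (ℚ.+-monoʳ-< p (ℚ.negative⁻¹ (ℚ.- 1ℚ)))

⊓-<ˡ : ∀ {p q r} → p ℚ.< r → p ℚ.⊓ q ℚ.< r
⊓-<ˡ p<r = ℚ.≤-<-trans (ℚ.p⊓q≤p _ _) p<r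

⊓-<ʳ : ∀ {p q r} → q ℚ.< r → p ℚ.⊓ q ℚ.< r
⊓-<ʳ {p} q<r = ℚ.≤-<-trans (ℚ.p⊓q≤q p _) q<r

<-⊓ : ∀ {p q r} → r ℚ.< p → r ℚ.< q → r ℚ.< p ℚ.⊓ q
<-⊓ {p} {q} {r} r<p r<q with ℚ.⊓-sel p q
... | inj₁ eq = subst (r ℚ.<_) (sym eq) r<p
... | inj₂ eq = subst (r ℚ.<_) (sym eq) r<q

⊔-< : ∀ {p q r} → p ℚ.< r → q ℚ.< r → p ℚ.⊔ q ℚ.< r
⊔-< {p} {q} {r} p<r q<r with ℚ.⊔-sel p q
... | inj₁ eq = subst (ℚ._< r) (sym eq) p<r
... | inj₂ eq = subst (ℚ._< r) (sym eq) q<r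

lower-bound : ∀ us → ∃[ t ] All (t ℚ.<_) us
lower-bound []       = 0ℚ , []
lower-bound (u ∷ us) = let t , t<us = lower-bound us in
  t ℚ.⊓ (u ℚ.- 1ℚ) , ⊓-<ʳ {t} (pred< u) ∷ All.map ⊓-<ˡ t<us

lower-bound-above : ∀ l us → All (l ℚ.<_) us → ∃[ t ] l ℚ.< t × All (t ℚ.<_) us
lower-bound-above l []       []           = l ℚ.+ 1ℚ , l<l+1 , []
  where
  l<l+1 : l ℚ.< l ℚ.+ 1ℚ
  l<l+1 = subst (ℚ._< l ℚ.+ 1ℚ) (ℚ.+-identityʳ l) (ℚ.+-monoʳ-< l (ℚ.positive⁻¹ 1ℚ))
lower-bound-above l (u ∷ us) (l<u ∷ l<us) =
  let t , l<t , t<us = lower-bound-above l us l<us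
      m , l<m , m<u  = ℚ.<-dense l<u
  in t ℚ.⊓ m , <-⊓ l<t l<m , ⊓-<ʳ {t} m<u ∷ All.map ⊓-<ˡ t<us

-- Density handles a single lower bound; the maximum of the points found for the individual lower
-- bounds stays below every upper bound.
interpolate : ∀ ls us → All (λ l → All (l ℚ.<_) us) ls →
              ∃[ t ] All (ℚ._< t) ls × All (t ℚ.<_) us
interpolate []       us []             = let t , t<us = lower-bound us in t , [] , t<us
interpolate (l ∷ ls) us (l<us ∷ ls<us) =
  let t  , ls<t , t<us = interpolate ls us ls<us
      t′ , l<t′ , t′<us = lower-bound-above l us l<us
  in t ℚ.⊔ t′
     , ℚ.<-≤-trans l<t′ (ℚ.p≤q⊔p t t′) ∷ All.map (λ l<t → ℚ.<-≤-trans l<t (ℚ.p≤p⊔q t t′)) ls<t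
     , All.zipWith (λ (p , q) → ⊔-< p q) (t<us , t′<us)

-- From left-right orderings to unit intervals.

module _ {n} (G : Graph n) where
  open Graph G hiding (Connected) renaming (sym to Adj-sym)

  LeftRight : List (Fin n) → Set
  LeftRight σ = ∀ {a b c} → Precedes σ a b → Precedes σ b c → Adj a c → Adj a b × Adj b c

  -- p and q are right endpoints of unit intervals for u and v.
  record Spaced (u v : Fin n) (p q : ℚ) : Set where
    field
      increasing : p ℚ.< q
      near       : Adj u v → q ℚ.- 1ℚ ℚ.< p
      far        : ¬ Adj u v → p ℚ.< q ℚ.- 1ℚ

  open Spaced

  Spacing : (Fin n → ℚ) → Rel (Fin n) 0ℓ
  Spacing f u v = Spaced u v (f u) (f v)

  -- Every requirement on `t` is a strict bound: below all later right endpoints, above the left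
  -- endpoints of neighbours of `x`, below those of non-neighbours. Interpolation then needs only
  -- that lower bounds lie below upper ones.
  insertion : ∀ {x xs f} → LeftRight (x ∷ xs) → AllPairs (Spacing f) xs →
    ∃[ t ] (∀ {y} → y ∈ xs → Spaced x y t (f y))
  insertion {x} {xs} {f} lr sp =
    let t , above , below = interpolate lowers uppers
          (All.tabulate λ l∈ → All.tabulate λ u∈ → separated l∈ u∈)
    in t , λ y∈ → record
      { increasing = All.lookup below (∈-++⁺ˡ (∈-map⁺ f y∈))
      ; near = λ xy → All.lookup above (∈-map⁺ f⁻ (∈-filter⁺ (adj? x) y∈ xy))
      ; far = λ ¬xy → All.lookup below (∈-++⁺ʳ (map f xs) (∈-map⁺ f⁻ (∈-filter⁺ (¬? ∘ adj? x) y∈ ¬xy)))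
      }
    where
    f⁻ : Fin n → ℚ
    f⁻ y = f y ℚ.- 1ℚ

    lowers uppers : List ℚ
    lowers = map f⁻ (filter (adj? x) xs)
    uppers = map f xs ++ map f⁻ (filter (¬? ∘ adj? x) xs)

    between : ∀ {y z} → y ∈ xs → Adj x y → Precedes xs z y → Adj x z × Adj z y
    between y∈ xy z<y = lr (refl ∷ from∈ (proj₁ (precedes-∈ z<y))) (x ∷ʳ z<y) xy

    below-near : ∀ {y z} → y ∈ xs → Adj x y → z ∈ xs → f⁻ y ℚ.< f z
    below-near {y} y∈ xy z∈ with precedes-total y∈ z∈
    ... | inj₁ refl       = pred< (f y)
    ... | inj₂ (inj₁ y<z) = ℚ.<-trans (pred< (f y)) (increasing (precedes-lookup sp y<z))
    -- Here `z` lies between `x` and its neighbour `y`, so `z` and `y` are adjacent and `near`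
    -- applies.
    ... | inj₂ (inj₂ z<y) = near (precedes-lookup sp z<y) (proj₂ (between y∈ xy z<y))

    below-far : ∀ {y z} → y ∈ xs → Adj x y → z ∈ xs → ¬ Adj x z → f⁻ y ℚ.< f⁻ z
    below-far {y} y∈ xy z∈ ¬xz with precedes-total y∈ z∈
    ... | inj₁ refl       = contradiction xy ¬xz
    ... | inj₂ (inj₁ y<z) = ℚ.+-monoˡ-< (ℚ.- 1ℚ) (increasing (precedes-lookup sp y<z))
    -- A non-neighbour of `x` cannot lie between `x` and a neighbour.
    ... | inj₂ (inj₂ z<y) = contradiction (proj₁ (between y∈ xy z<y)) ¬xz

    separated : ∀ {l u} → l ∈ lowers → u ∈ uppers → l ℚ.< u
    separated l∈ u∈ with ∈-map⁻ f⁻ l∈ | ∈-++⁻ (map f xs) u∈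
    ... | y , y∈ , refl | inj₁ u∈₁ with ∈-filter⁻ (adj? x) {xs = xs} y∈ | ∈-map⁻ f u∈₁
    ...   | y∈xs , xy | z , z∈ , refl = below-near y∈xs xy z∈
    separated l∈ u∈ | y , y∈ , refl | inj₂ u∈₂
      with ∈-filter⁻ (adj? x) {xs = xs} y∈ | ∈-map⁻ f⁻ u∈₂
    ...   | y∈xs , xy | z , z∈ , refl with ∈-filter⁻ (¬? ∘ adj? x) {xs = xs} z∈
    ...     | z∈xs , ¬xz = below-far y∈xs xy z∈xs ¬xz

  update : Fin n → ℚ → (Fin n → ℚ) → Fin n → ℚ
  update x t f y with y Fin.≟ x
  ... | yes _ = t
  ... | no _  = f y

  update-≡ : ∀ x {t f} → update x t f x ≡ t
  update-≡ x with x Fin.≟ x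
  ... | yes _  = refl
  ... | no x≢x = contradiction refl x≢x

  update-≢ : ∀ {x t f y} → x ≢ y → update x t f y ≡ f y
  update-≢ {x} {y = y} x≢y with y Fin.≟ x
  ... | yes y≡x = contradiction (sym y≡x) x≢y
  ... | no _    = refl

  spacing : ∀ {σ} → Unique σ → LeftRight σ → ∃[ f ] AllPairs (Spacing f) σ
  spacing {[]}     _        _  = (λ _ → 0ℚ) , []
  spacing {x ∷ xs} (x≢ ∷ u) lr with spacing u (λ p q → lr (x ∷ʳ p) (x ∷ʳ q))
  ... | f , sp with insertion lr sp
  ...   | t , fits = g , All.tabulate first ∷ AllPairs-map-∈ move sp
    where
    g : Fin n → ℚ
    g = update x t f

    g-old : ∀ {y} → y ∈ xs → f y ≡ g y
    g-old y∈ = sym (update-≢ (All.lookup x≢ y∈))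

    g-new : t ≡ g x
    g-new = sym (update-≡ x)

    first : ∀ {y} → y ∈ xs → Spacing g x y
    first y∈ = subst₂ (Spaced x _) g-new (g-old y∈) (fits y∈)

    move : ∀ {a b} → a ∈ xs → b ∈ xs → Spacing f a b → Spacing g a b
    move a∈ b∈ = subst₂ (Spaced _ _) (g-old a∈) (g-old b∈)

  leftRight⇒uig : ∀ {σ} → Unique σ → (∀ v → v ∈ σ) → LeftRight σ → UnitIntervalGraph G
  leftRight⇒uig {σ} u all lr with spacing u lr
  ... | f , sp = I , equal , model
    where
    I : Fin n → ClosedInterval
    I v = record
      { lo    = const (f v ℚ.- 1ℚ)
      ; hi    = const (f v)
      ; lo≤hi = const-mono-≤ (ℚ.<⇒≤ (pred< (f v)))
      }

    width≡1 : ∀ v → f v ℚ.- (f v ℚ.- 1ℚ) ≡ 1ℚ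
    width≡1 v = solve 1 (λ p → p :- (p :- con 1ℚ) := con 1ℚ) refl (f v)
      where open +-*-Solver

    width≤ : ∀ u v → width (I u) ≤ᴿ width (I v)
    width≤ u v = pointwise-≤ {width (I u)} {width (I v)} λ _ →
      ℚ.≤-reflexive (trans (width≡1 u) (sym (width≡1 v)))

    equal : ∀ u v → width (I u) ≃ width (I v)
    equal u v = width≤ u v , width≤ v u

    meets : ∀ {u v} → Spacing f u v → Adj u v → Intersect (I u) (I v)
    meets {u} {v} s uv = intersect⁺ {I u} {I v}
      (const-mono-≤ (ℚ.+-monoˡ-≤ (ℚ.- 1ℚ) (ℚ.<⇒≤ (increasing s))))
      (const-mono-≤ (ℚ.<⇒≤ (near s uv)))

    adjacent : ∀ {u v} → Spacing f u v → Intersect (I u) (I v) → Adj u v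
    adjacent {u} {v} s int = decidable-stable (adj? u v) λ ¬uv →
      ℚ.<-irrefl refl (ℚ.<-≤-trans (far s ¬uv) (const-cancel-≤ (intersect⁻ {I u} {I v} int)))

    model : ∀ u v → u ≢ v → Adj u v ⇔ Intersect (I u) (I v)
    model u v u≢v with precedes-total (all u) (all v)
    ... | inj₁ u≡v        = contradiction u≡v u≢v
    ... | inj₂ (inj₁ u<v) = let s = precedes-lookup sp u<v in mk⇔ (meets s) (adjacent s)
    ... | inj₂ (inj₂ v<u) = let s = precedes-lookup sp v<u in
      mk⇔ (intersect-sym {I v} {I u} ∘ meets s ∘ Adj-sym)
          (Adj-sym ∘ adjacent s ∘ intersect-sym {I u} {I v})

theorem7 : (n : ℕ) (G : Graph n) → Connected G →
    (σ : List (Fin n)) → TwoPass G σ →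
    UnitIntervalGraph G ⇔ IsLeftRightOrdering G (Precedes σ)
theorem7 n G conn σ tp = mk⇔ (uig⇒leftRight G conn tp)
  λ lr → leftRight⇒uig G (bfs-unique pass₂) (bfs-complete pass₂ conn) (IsLeftRightOrdering.leftRight lr)
  where
  open TwoPass tp
  open Search G using (bfs-unique; bfs-complete)
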